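{- For any residue system $C$, we have $\delta(C)\ge\alpha(C)-\beta(C)$.
   Context: A residue system is a finite set $C=\{(n_1,r_1),\ldots,(n_l,r_l)\}$ of ordered pairs of positive integers, each pair $(n,r)$ being interpreted as the residue class $r\pmod n$ (the moduli $n_i$ need not be distinct). $R(C)$ is the set of integers not congruent to $r\pmod n$ for any $(n,r)\in C$, and $\delta(C)$ is the asymptotic density of $R(C)$ (which exists, since $R(C)$ is a union of residue classes modulo the least common multiple of the moduli). Further \[ \alpha(C)=\prod_{j=1}^l\left(1-\frac1{n_j}\right),\qquad \beta(C)=\sum_{\substack{1\le i<j\le l\\ \gcd(n_i,n_j)>1}}\frac1{n_in_j}. \] -}

module Defs where

open import Data.Nat as ℕ using (ℕ; zero; suc; NonZero)
import Data.Nat.Properties as ℕ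
import Data.Nat.DivMod as ℕ
open import Data.Nat.GCD using (gcd)
open import Data.Nat.ListAction using (product)
open import Data.Nat.ListAction.Properties using (product≢0; ∈⇒∣product)
open import Data.Integer as ℤ using (ℤ; +_; -[1+_])
import Data.Integer.Properties as ℤ
open import Data.Integer.Divisibility.Signed as ℤ using (_∣_; _∣?_)
open import Data.Integer.Tactic.RingSolver using (solve-∀)
open import Data.Rational as ℚ using (ℚ; mkℚ; 0ℚ; 1ℚ; _/_)
import Data.Rational.Properties as ℚ
open import Data.Rational.Unnormalised as ℚᵘ using (mkℚᵘ; *<*)
import Data.Rational.Unnormalised.Properties as ℚᵘ
open import Data.List using (List; []; _∷_; _++_; map; filter; foldr; length)
import Data.List.Properties as List
open import Data.List.Membership.Propositional using (_∈_)
open import Data.List.Membership.Propositional.Properties using (∈-map⁺)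
open import Data.List.Relation.Unary.All as All using (All)
import Data.List.Relation.Unary.All.Properties as All
open import Data.List.Relation.Unary.Unique.Propositional using (Unique)
open import Data.Product using (∃; _×_; _,_; proj₁; proj₂)
open import Level using (0ℓ)
open import Relation.Nullary using (¬_; ¬?; recompute; yes; no)
open import Relation.Nullary.Negation using (contradiction)
open import Relation.Unary using (Pred; Decidable)
open import Relation.Binary.PropositionalEquality
  using (_≡_; refl; sym; trans; cong; cong₂; subst; module ≡-Reasoning)

-- The positivity proofs are irrelevant, so equality of classes is equality of
-- the pairs (modulus , residue): (2 , 1) and (2 , 3) are different elements.
record ResidueClass : Set where
  constructor class
  field
    modulus residue       : ℕ
    .{{modulus-positive}} : NonZero modulus
    .{{residue-positive}} : NonZero residue

open ResidueClass public using (modulus; residue)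

modulus≢0 : ∀ c → NonZero (modulus c)
modulus≢0 (class n r {{n>0}}) = recompute (ℕ.nonZero? n) n>0

-- A finite set is a duplicate-free list; nothing below depends on its order.
record ResidueSystem : Set where
  field
    classes  : List ResidueClass
    distinct : Unique classes

open ResidueSystem public

Avoids : List ResidueClass → Pred ℤ 0ℓ
Avoids cs x = All (λ c → ¬ + modulus c ∣ x ℤ.- + residue c) cs

avoids? : ∀ cs → Decidable (Avoids cs)
avoids? cs x = All.all? (λ c → ¬? (+ modulus c ∣? x ℤ.- + residue c)) cs

R : ResidueSystem → Pred ℤ 0ℓ
R C = Avoids (classes C)

R? : ∀ C → Decidable (R C)
R? C = avoids? (classes C)

-- The n consecutive integers a, a + 1, …, a + n - 1.
window : ℤ → ℕ → List ℤ
window a zero    = []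
window a (suc n) = a ∷ window (ℤ.suc a) n

count : {P : Pred ℤ 0ℓ} → Decidable P → ℤ → ℕ → ℕ
count P? a n = length (filter P? (window a n))

-- d = lim_{N → ∞} #(P ∩ [-N , N]) / (2N + 1).
HasDensity : {P : Pred ℤ 0ℓ} → Decidable P → ℚ → Set
HasDensity P? d =
  ∀ ε → 0ℚ ℚ.< ε → ∃ λ N₀ → ∀ N → N₀ ℕ.≤ N →
  ℚ.∣ + count P? (ℤ.- + N) (suc (2 ℕ.* N)) / suc (2 ℕ.* N) ℚ.- d ∣ ℚ.< ε

-- Existence of the density of a periodic set: over n consecutive integers the
-- count differs from its expected value by a bounded amount.

module _ {P : Pred ℤ 0ℓ} (P? : Decidable P) where

  window-++ : ∀ a m n → window a (m ℕ.+ n) ≡ window a m ++ window (a ℤ.+ + m) n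
  window-++ a zero    n = cong (λ b → window b n) (sym (ℤ.+-identityʳ a))
  window-++ a (suc m) n = cong (a ∷_) (trans (window-++ (ℤ.suc a) m n)
    (cong (λ b → window (ℤ.suc a) m ++ window b n) (shift a (+ m))))
    where
    shift : ∀ a b → (+ 1 ℤ.+ a) ℤ.+ b ≡ a ℤ.+ (+ 1 ℤ.+ b)
    shift = solve-∀

  count-+ : ∀ a m n →
            count P? a (m ℕ.+ n) ≡ count P? a m ℕ.+ count P? (a ℤ.+ + m) n
  count-+ a m n = begin
    length (filter P? (window a (m ℕ.+ n)))
      ≡⟨ cong (λ w → length (filter P? w)) (window-++ a m n) ⟩
    length (filter P? (window a m ++ window (a ℤ.+ + m) n))
      ≡⟨ cong length (List.filter-++ P? (window a m) _) ⟩
    length (filter P? (window a m) ++ filter P? (window (a ℤ.+ + m) n))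
      ≡⟨ List.length-++ (filter P? (window a m)) ⟩
    count P? a m ℕ.+ count P? (a ℤ.+ + m) n ∎
    where open ≡-Reasoning

  length-window : ∀ a n → length (window a n) ≡ n
  length-window a zero    = refl
  length-window a (suc n) = cong suc (length-window (ℤ.suc a) n)

  count≤ : ∀ a n → count P? a n ℕ.≤ n
  count≤ a n = subst (count P? a n ℕ.≤_) (length-window a n)
                     (List.length-filter P? (window a n))

  module Periodic (L : ℕ) .{{_ : NonZero L}}
                  (P⇒ : ∀ x → P x → P (x ℤ.+ + L))
                  (P⇐ : ∀ x → P (x ℤ.+ + L) → P x) where

    count-shift : ∀ a n → count P? (a ℤ.+ + L) n ≡ count P? a n
    count-shift a zero = refl
    count-shift a (suc n)
      with ih ← trans (cong (λ b → count P? b n)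
                            (sym (ℤ.+-assoc (+ 1) a (+ L))))
                      (count-shift (ℤ.suc a) n)
      with P? (a ℤ.+ + L) | P? a
    ... | yes _ | yes _ = cong suc ih
    ... | yes p | no ¬p = contradiction (P⇐ a p) ¬p
    ... | no ¬p | yes p = contradiction (P⇒ a p) ¬p
    ... | no _  | no _  = ih

    count-suc : ∀ a → count P? (ℤ.suc a) L ≡ count P? a L
    count-suc a = ℕ.+-cancelˡ-≡ (count P? a 1) _ _ (begin
      count P? a 1 ℕ.+ count P? (ℤ.suc a) L
        ≡⟨ cong (λ b → count P? a 1 ℕ.+ count P? b L) (ℤ.+-comm (+ 1) a) ⟩
      count P? a 1 ℕ.+ count P? (a ℤ.+ + 1) L ≡⟨ count-+ a 1 L ⟨
      count P? a (1 ℕ.+ L) ≡⟨ cong (count P? a) (ℕ.+-comm 1 L) ⟩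
      count P? a (L ℕ.+ 1) ≡⟨ count-+ a L 1 ⟩
      count P? a L ℕ.+ count P? (a ℤ.+ + L) 1
        ≡⟨ cong (count P? a L ℕ.+_) (count-shift a 1) ⟩
      count P? a L ℕ.+ count P? a 1 ≡⟨ ℕ.+-comm (count P? a L) _ ⟩
      count P? a 1 ℕ.+ count P? a L ∎)
      where open ≡-Reasoning

    perPeriod : ℕ
    perPeriod = count P? (+ 0) L

    count-period : ∀ a → count P? a L ≡ perPeriod
    count-period (+ zero)      = refl
    count-period (+ suc n)     = trans (count-suc (+ n)) (count-period (+ n))
    count-period -[1+ zero ]   = sym (count-suc -[1+ 0 ])
    count-period -[1+ suc n ]  =
      trans (sym (count-suc -[1+ suc n ])) (count-period -[1+ n ])

    count-periods : ∀ a q → count P? a (q ℕ.* L) ≡ q ℕ.* perPeriod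
    count-periods a zero    = refl
    count-periods a (suc q) = trans (count-+ a L (q ℕ.* L))
      (cong₂ ℕ._+_ (count-period a) (count-periods (a ℤ.+ + L) q))

    deviation : ∀ a n →
      ℤ.∣ + count P? a n ℤ.* + L ℤ.+ (ℤ.- + perPeriod) ℤ.* + n ∣ ℕ.≤ L ℕ.* L
    deviation a n = begin
      ℤ.∣ + count P? a n ℤ.* + L ℤ.+ (ℤ.- + c) ℤ.* + n ∣
        ≡⟨ cong ℤ.∣_∣ (cong₂ (λ k m → + k ℤ.* + L ℤ.+ (ℤ.- + c) ℤ.* + m)
             count≡ n≡) ⟩
      ℤ.∣ + (t ℕ.+ q ℕ.* c) ℤ.* + L ℤ.+ (ℤ.- + c) ℤ.* + (r ℕ.+ q ℕ.* L) ∣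
        ≡⟨ cong ℤ.∣_∣ (trans
             (cong₂ (λ u v → (+ t ℤ.+ u) ℤ.* + L ℤ.+ (ℤ.- + c) ℤ.* (+ r ℤ.+ v))
                    (ℤ.pos-* q c) (ℤ.pos-* q L))
             (trans (cancel (+ t) (+ q) (+ c) (+ L) (+ r))
             (cong₂ ℤ._-_ (sym (ℤ.pos-* t L)) (sym (ℤ.pos-* c r))))) ⟩
      ℤ.∣ + (t ℕ.* L) ℤ.- + (c ℕ.* r) ∣
        ≡⟨ cong ℤ.∣_∣ (ℤ.m-n≡m⊖n (t ℕ.* L) (c ℕ.* r)) ⟩
      ℤ.∣ t ℕ.* L ℤ.⊖ c ℕ.* r ∣
        ≤⟨ ℤ.∣m⊝n∣≤m⊔n (t ℕ.* L) (c ℕ.* r) ⟩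
      t ℕ.* L ℕ.⊔ c ℕ.* r
        ≤⟨ ℕ.⊔-lub (ℕ.*-monoˡ-≤ L (ℕ.≤-trans (count≤ a r) r≤L))
                   (ℕ.*-mono-≤ (count≤ (+ 0) L) r≤L) ⟩
      L ℕ.* L ∎
      where
      open ℕ.≤-Reasoning
      c = perPeriod
      q = n ℕ./ L
      r = n ℕ.% L
      t = count P? a r
      r≤L : r ℕ.≤ L
      r≤L = ℕ.<⇒≤ (ℕ.m%n<n n L)
      n≡ : n ≡ r ℕ.+ q ℕ.* L
      n≡ = ℕ.m≡m%n+[m/n]*n n L
      count≡ : count P? a n ≡ t ℕ.+ q ℕ.* c
      count≡ = trans (cong (count P? a) n≡) (trans (count-+ a r (q ℕ.* L))
                 (cong (t ℕ.+_) (count-periods (a ℤ.+ + r) q)))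
      cancel : ∀ t q c L r →
        (t ℤ.+ q ℤ.* c) ℤ.* L ℤ.+ (ℤ.- c) ℤ.* (r ℤ.+ q ℤ.* L)
        ≡ t ℤ.* L ℤ.- c ℤ.* r
      cancel = solve-∀

toℚᵘ-distance : ∀ i m j n →
  ℚ.toℚᵘ ℚ.∣ i / suc m ℚ.- j / suc n ∣ ℚᵘ.≃ ℚᵘ.∣ mkℚᵘ i m ℚᵘ.- mkℚᵘ j n ∣
toℚᵘ-distance i m j n = begin
  ℚ.toℚᵘ ℚ.∣ p ℚ.- q ∣               ≈⟨ ℚ.toℚᵘ-homo-∣-∣ (p ℚ.- q) ⟩
  ℚᵘ.∣ ℚ.toℚᵘ (p ℚ.- q) ∣            ≈⟨ ℚᵘ.∣-∣-cong (ℚ.toℚᵘ-homo-+ p (ℚ.- q)) ⟩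
  ℚᵘ.∣ ℚ.toℚᵘ p ℚᵘ.+ ℚ.toℚᵘ (ℚ.- q) ∣
    ≈⟨ ℚᵘ.∣-∣-cong (ℚᵘ.+-cong (ℚ.toℚᵘ-fromℚᵘ (mkℚᵘ i m))
         (ℚᵘ.≃-trans (ℚ.toℚᵘ-homo‿- q)
                     (ℚᵘ.-‿cong (ℚ.toℚᵘ-fromℚᵘ (mkℚᵘ j n))))) ⟩
  ℚᵘ.∣ mkℚᵘ i m ℚᵘ.- mkℚᵘ j n ∣      ∎
  where
  open import Relation.Binary.Reasoning.Setoid ℚᵘ.≃-setoid
  p = i / suc m
  q = j / suc n

periodic-density : {P : Pred ℤ 0ℓ} (P? : Decidable P) (L : ℕ) .{{_ : NonZero L}} →
                   (∀ x → P x → P (x ℤ.+ + L)) → (∀ x → P (x ℤ.+ + L) → P x) →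
                   HasDensity P? (+ count P? (+ 0) L / L)
periodic-density P? L@(suc l) P⇒ P⇐ (mkℚ (+ zero) q-1 _) (ℚ.*<* (ℤ.+<+ ()))
periodic-density P? L@(suc l) P⇒ P⇐ (mkℚ -[1+ _ ] q-1 _) (ℚ.*<* ())
periodic-density P? L@(suc l) P⇒ P⇐ ε@(mkℚ (+ suc p) q-1 _) _ = L ℕ.* q , close
  where
  open Periodic P? L P⇒ P⇐
  q = suc q-1
  close : ∀ N → L ℕ.* q ℕ.≤ N →
    ℚ.∣ + count P? (ℤ.- + N) (suc (2 ℕ.* N)) / suc (2 ℕ.* N)
        ℚ.- + perPeriod / L ∣ ℚ.< ε
  close N N₀≤N = ℚ.toℚᵘ-cancel-<
    (ℚᵘ.<-respˡ-≃ (ℚᵘ.≃-sym (toℚᵘ-distance (+ k) (2 ℕ.* N) (+ perPeriod) l))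
      (*<* (subst₂′ (ℤ.pos-* X q) (ℤ.+<+ bound))))
    where
    n = suc (2 ℕ.* N)
    k = count P? (ℤ.- + N) n
    X = ℤ.∣ + k ℤ.* + L ℤ.+ (ℤ.- + perPeriod) ℤ.* + n ∣
    subst₂′ : ∀ {a b c} → a ≡ b → a ℤ.< c → b ℤ.< c
    subst₂′ refl h = h
    bound : X ℕ.* q ℕ.< suc p ℕ.* (n ℕ.* L)
    bound = begin-strict
      X ℕ.* q             ≤⟨ ℕ.*-monoˡ-≤ q (deviation (ℤ.- + N) n) ⟩
      L ℕ.* L ℕ.* q       ≡⟨ ℕ.*-assoc L L q ⟩
      L ℕ.* (L ℕ.* q)     ≡⟨ ℕ.*-comm L (L ℕ.* q) ⟩
      L ℕ.* q ℕ.* L       <⟨ ℕ.*-monoˡ-< L (ℕ.s≤s (ℕ.≤-trans N₀≤N (ℕ.m≤n*m N 2))) ⟩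
      n ℕ.* L             ≤⟨ ℕ.m≤n*m (n ℕ.* L) (suc p) ⟩
      suc p ℕ.* (n ℕ.* L) ∎
      where open ℕ.≤-Reasoning

period : List ResidueClass → ℕ
period cs = product (map modulus cs)

period≢0 : ∀ cs → NonZero (period cs)
period≢0 cs = product≢0 (All.map⁺ (All.universal modulus≢0 cs))

modulus∣period : ∀ {c cs} → c ∈ cs → + modulus c ∣ + period cs
modulus∣period c∈cs = ℤ.∣ᵤ⇒∣ (∈⇒∣product (∈-map⁺ modulus c∈cs))

x+L-r : ∀ x L r → x ℤ.+ L ℤ.- r ≡ (x ℤ.- r) ℤ.+ L
x+L-r = solve-∀

avoids⇒ : ∀ cs x → Avoids cs x → Avoids cs (x ℤ.+ + period cs)
avoids⇒ cs x av = All.tabulate λ {c} c∈cs h → All.lookup av c∈cs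
  (ℤ.∣m+n∣n⇒∣m (subst (+ modulus c ∣_) (x+L-r x (+ period cs) (+ residue c)) h)
               (modulus∣period c∈cs))

avoids⇐ : ∀ cs x → Avoids cs (x ℤ.+ + period cs) → Avoids cs x
avoids⇐ cs x av = All.tabulate λ {c} c∈cs h → All.lookup av c∈cs
  (subst (+ modulus c ∣_) (sym (x+L-r x (+ period cs) (+ residue c)))
         (ℤ.∣m∣n⇒∣m+n h (modulus∣period c∈cs)))

density-exists : ∀ C → ∃ (HasDensity (R? C))
density-exists C = _ , periodic-density (R? C) (period cs) {{period≢0 cs}}
                            (avoids⇒ cs) (avoids⇐ cs)
  where cs = classes C

δ : ResidueSystem → ℚ
δ C = proj₁ (density-exists C)

δ-isDensity : ∀ C → HasDensity (R? C) (δ C)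
δ-isDensity C = proj₂ (density-exists C)

αFactor : ResidueClass → ℚ
αFactor (class n _) = 1ℚ ℚ.- + 1 / n

α : ResidueSystem → ℚ
α C = foldr ℚ._*_ 1ℚ (map αFactor (classes C))

-- All (x_i , x_j) with i < j.
orderedPairs : {A : Set} → List A → List (A × A)
orderedPairs []       = []
orderedPairs (x ∷ xs) = map (x ,_) xs ++ orderedPairs xs

NotCoprime : Pred (ResidueClass × ResidueClass) 0ℓ
NotCoprime (c , d) = gcd (modulus c) (modulus d) ℕ.> 1

notCoprime? : Decidable NotCoprime
notCoprime? (c , d) = gcd (modulus c) (modulus d) ℕ.>? 1

βTerm : ResidueClass × ResidueClass → ℚ
βTerm (class m _ , class n _) = + 1 / (m ℕ.* n)
  where instance _ = ℕ.m*n≢0 m n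

β : ResidueSystem → ℚ
β C = foldr ℚ._+_ 0ℚ
  (map βTerm (filter notCoprime? (orderedPairs (classes C))))

{-# OPTIONS --safe #-}

-- Split off one class c = (n , r) from c ∷ cs, and let ds be the classes of cs
-- whose modulus is coprime to n.  By the Chinese remainder theorem the integers
-- of c avoiding ds have density δ(ds) / n, and δ(ds) exceeds δ(cs) by at most
-- the sum of the 1 / m over the moduli m in cs not coprime to n.  Hence
--   δ(c ∷ cs) ≥ (1 - 1/n) δ(cs) - Σ 1/(n m),
-- and the bound follows by induction on the number of classes.
module Submission where

open import Defs
open import Data.Rational using (_≥_; _-_)
open import Data.Nat as ℕ using (ℕ; zero; suc; NonZero)
import Data.Nat.Properties as ℕ
import Data.Nat.Divisibility as ℕ
import Data.Nat.Tactic.RingSolver as ℕ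
open import Data.Nat.Coprimality as Coprime using (Coprime)
open import Data.Nat.GCD using (module Bézout)
import Data.Nat.GCD as GCD
open import Data.Nat.ListAction using (sum; product)
open import Data.Integer as ℤ using (ℤ; +_)
import Data.Integer.Properties as ℤ
open import Data.Integer.Divisibility.Signed as ℤ using (_∣_; _∣?_)
open import Data.Integer.Tactic.RingSolver using (solve-∀)
open import Data.Rational as ℚ using (ℚ; 0ℚ; 1ℚ; _/_)
import Data.Rational.Properties as ℚ
open import Data.Rational.Solver using (module +-*-Solver)
open import Data.Rational.Unnormalised as ℚᵘ using (mkℚᵘ; *≡*; *≤*)
import Data.Rational.Unnormalised.Properties as ℚᵘ
open import Data.List using (List; []; _∷_; _++_; map; filter; foldr; length)
import Data.List.Properties as List
open import Data.List.Membership.Propositional using (_∈_)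
open import Data.List.Membership.Propositional.Properties using (∈-filter⁺)
open import Data.List.Relation.Unary.All as All using (All; []; _∷_)
import Data.List.Relation.Unary.All.Properties as All
open import Data.List.Relation.Unary.Any as Any using (Any; here; there)
open import Data.Product using (∃; _×_; _,_)
open import Data.Sum using (_⊎_; inj₁; inj₂)
open import Function using (_∘_)
open import Level using (0ℓ)
open import Relation.Nullary using (¬_; ¬?; Dec; yes; no)
open import Relation.Nullary.Decidable using (_×-dec_)
open import Relation.Nullary.Negation using (contradiction)
open import Relation.Unary using (Pred; Decidable)
open import Relation.Binary.PropositionalEquality
  using (_≡_; refl; sym; trans; cong; cong₂; subst; module ≡-Reasoning)

private
  variable
    A B : Set
    P Q : Pred ℤ 0ℓ

-- Sums and indicators

∑ : List A → (A → ℕ) → ℕ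
∑ xs f = sum (map f xs)

∑-cong : ∀ {f g : A → ℕ} xs → (∀ x → f x ≡ g x) → ∑ xs f ≡ ∑ xs g
∑-cong xs f≗g = cong sum (List.map-cong f≗g xs)

∑-mono-≤ : ∀ {f g : A → ℕ} xs → (∀ x → f x ℕ.≤ g x) → ∑ xs f ℕ.≤ ∑ xs g
∑-mono-≤ []       f≤g = ℕ.z≤n
∑-mono-≤ (x ∷ xs) f≤g = ℕ.+-mono-≤ (f≤g x) (∑-mono-≤ xs f≤g)

∑-+ : ∀ (f g : A → ℕ) xs → ∑ xs (λ x → f x ℕ.+ g x) ≡ ∑ xs f ℕ.+ ∑ xs g
∑-+ f g []       = refl
∑-+ f g (x ∷ xs) = trans (cong (f x ℕ.+ g x ℕ.+_) (∑-+ f g xs))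
                         (interchange (f x) (g x) (∑ xs f) (∑ xs g))
  where
  interchange : ∀ a b c d → a ℕ.+ b ℕ.+ (c ℕ.+ d) ≡ a ℕ.+ c ℕ.+ (b ℕ.+ d)
  interchange = ℕ.solve-∀

∑-const : ∀ k (xs : List A) → ∑ xs (λ _ → k) ≡ length xs ℕ.* k
∑-const k []       = refl
∑-const k (x ∷ xs) = cong (k ℕ.+_) (∑-const k xs)

∑-swap : ∀ (f : A → B → ℕ) xs ys →
         ∑ xs (λ x → ∑ ys (f x)) ≡ ∑ ys (λ y → ∑ xs (λ x → f x y))
∑-swap f []       ys = sym (trans (∑-const 0 ys) (ℕ.*-zeroʳ (length ys)))
∑-swap f (x ∷ xs) ys = trans (cong (∑ ys (f x) ℕ.+_) (∑-swap f xs ys))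
                             (sym (∑-+ (f x) _ ys))

𝟙 : {X : Set} → Dec X → ℕ
𝟙 (yes _) = 1
𝟙 (no  _) = 0

𝟙-mono : {X Y : Set} (x? : Dec X) (y? : Dec Y) → (X → Y) → 𝟙 x? ℕ.≤ 𝟙 y?
𝟙-mono (yes x) (yes y) f = ℕ.≤-refl
𝟙-mono (yes x) (no ¬y) f = contradiction (f x) ¬y
𝟙-mono (no _)  y?      f = ℕ.z≤n

𝟙-cong : {X Y : Set} (x? : Dec X) (y? : Dec Y) → (X → Y) → (Y → X) → 𝟙 x? ≡ 𝟙 y?
𝟙-cong x? y? f g = ℕ.≤-antisym (𝟙-mono x? y? f) (𝟙-mono y? x? g)

𝟙-× : {X Y : Set} (x? : Dec X) (y? : Dec Y) → 𝟙 (x? ×-dec y?) ≡ 𝟙 x? ℕ.* 𝟙 y?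
𝟙-× (yes _) (yes _) = refl
𝟙-× (yes _) (no  _) = refl
𝟙-× (no  _) y?      = refl

𝟙-⊎ : {X Y Z : Set} (x? : Dec X) (y? : Dec Y) (z? : Dec Z) →
      (X → Y ⊎ Z) → 𝟙 x? ℕ.≤ 𝟙 y? ℕ.+ 𝟙 z?
𝟙-⊎ (no _)  y? z? f = ℕ.z≤n
𝟙-⊎ (yes x) y? z? f with f x
... | inj₁ y = ℕ.m≤n⇒m≤n+o (𝟙 z?) (𝟙-mono (yes x) y? λ _ → y)
... | inj₂ z = ℕ.m≤n⇒m≤o+n (𝟙 y?) (𝟙-mono (yes x) z? λ _ → z)

∑-any : {S : Pred A 0ℓ} (S? : Decidable S) {xs : List A} →
        Any S xs → 1 ℕ.≤ ∑ xs (𝟙 ∘ S?)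
∑-any S? {x ∷ xs} (here s) = ℕ.≤-trans (𝟙-mono (yes s) (S? x) λ s → s) (ℕ.m≤m+n _ _)
∑-any S? {x ∷ xs} (there s) = ℕ.≤-trans (∑-any S? s) (ℕ.m≤n+m _ _)

length-filter≡∑ : {S : Pred A 0ℓ} (S? : Decidable S) (xs : List A) →
                  length (filter S? xs) ≡ ∑ xs (𝟙 ∘ S?)
length-filter≡∑ S? []       = refl
length-filter≡∑ S? (x ∷ xs) with S? x
... | yes _ = cong suc (length-filter≡∑ S? xs)
... | no  _ = length-filter≡∑ S? xs

-- Counting in windows

window-translate : ∀ a s n → window (a ℤ.+ s) n ≡ map (ℤ._+ s) (window a n)
window-translate a s zero    = refl
window-translate a s (suc n) = cong (a ℤ.+ s ∷_)
  (trans (cong (λ b → window b n) (sym (ℤ.+-assoc (+ 1) a s)))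
         (window-translate (ℤ.suc a) s n))

-- Translation by `s` matches the two windows element by element. The two predicates may differ, so
-- a count for one residue can be compared with a count for another.
count-translate : (P? : Decidable P) (Q? : Decidable Q) (s : ℤ) →
                  (∀ x → P x → Q (x ℤ.+ s)) → (∀ x → Q (x ℤ.+ s) → P x) →
                  ∀ a n → count Q? (a ℤ.+ s) n ≡ count P? a n
count-translate P? Q? s P⇒Q Q⇒P a n = begin
  count Q? (a ℤ.+ s) n                 ≡⟨ length-filter≡∑ Q? (window (a ℤ.+ s) n) ⟩
  ∑ (window (a ℤ.+ s) n) (𝟙 ∘ Q?)      ≡⟨ cong (λ w → ∑ w (𝟙 ∘ Q?)) (window-translate a s n) ⟩
  ∑ (map (ℤ._+ s) (window a n)) (𝟙 ∘ Q?)
    ≡⟨ cong sum (List.map-∘ (window a n)) ⟨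
  ∑ (window a n) (λ x → 𝟙 (Q? (x ℤ.+ s)))
    ≡⟨ ∑-cong (window a n) (λ x → 𝟙-cong (Q? (x ℤ.+ s)) (P? x) (Q⇒P x) (P⇒Q x)) ⟩
  ∑ (window a n) (𝟙 ∘ P?)              ≡⟨ length-filter≡∑ P? (window a n) ⟨
  count P? a n                         ∎
  where open ≡-Reasoning

window-all : ∀ a n → (∀ i → i ℕ.< n → P (a ℤ.+ + i)) → All P (window a n)
window-all         a zero    p = []
window-all {P = P} a (suc n) p =
  subst P (ℤ.+-identityʳ a) (p 0 ℕ.z<s) ∷
  window-all (ℤ.suc a) n λ i i<n → subst P (assoc a (+ i)) (p (suc i) (ℕ.s<s i<n))
  where
  assoc : ∀ a i → a ℤ.+ (+ 1 ℤ.+ i) ≡ + 1 ℤ.+ a ℤ.+ i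
  assoc = solve-∀

∣-shift : ∀ {k x y s} → k ∣ s → y ≡ x ℤ.+ s → k ∣ x → k ∣ y
∣-shift {k} k∣s y≡x+s k∣x = subst (k ∣_) (sym y≡x+s) (ℤ.∣m∣n⇒∣m+n k∣x k∣s)

∣-unshift : ∀ {k x y s} → k ∣ s → y ≡ x ℤ.+ s → k ∣ y → k ∣ x
∣-unshift {k} k∣s y≡x+s k∣y = ℤ.∣m+n∣n⇒∣m (subst (k ∣_) y≡x+s k∣y) k∣s

congruent? : ∀ n r → Decidable (λ x → + n ∣ x ℤ.- r)
congruent? n r x = + n ∣? x ℤ.- r

∣-flip : ∀ {k} x y → k ∣ x ℤ.- y → k ∣ y ℤ.- x
∣-flip {k} x y k∣ = subst (k ∣_) (flip x y) (ℤ.∣m⇒∣-m k∣)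
  where
  flip : ∀ x y → ℤ.- (x ℤ.- y) ≡ y ℤ.- x
  flip = solve-∀

count-congruent : ∀ n .{{_ : NonZero n}} r → count (congruent? n r) (+ 0) n ≡ 1
count-congruent n@(suc m) r = trans (sym (count-period r)) at-r
  where
  open Periodic (congruent? n r) n
    (λ x → ∣-shift ℤ.∣-refl (x+L-r x (+ n) r))
    (λ x → ∣-unshift ℤ.∣-refl (x+L-r x (+ n) r))
  offset : ∀ i → (+ 1 ℤ.+ r) ℤ.+ + i ℤ.- r ≡ + suc i
  offset i = cancel r (+ i)
    where
    cancel : ∀ r i → (+ 1 ℤ.+ r) ℤ.+ i ℤ.- r ≡ + 1 ℤ.+ i
    cancel = solve-∀
  rest : filter (congruent? n r) (window (ℤ.suc r) m) ≡ []
  -- By periodicity the window may start at `r`. Its later elements exceed `r` by `suc i`, which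
  -- lies strictly between 0 and `n` and so is no multiple of `n`; only `r` itself is counted.
  rest = List.filter-none (congruent? n r) (window-all (ℤ.suc r) m λ i i<m n∣ →
    ℕ.<⇒≱ (ℕ.s<s i<m) (ℕ.∣⇒≤ (ℤ.∣⇒∣ᵤ (subst (+ n ∣_) (offset i) n∣))))
  at-r : count (congruent? n r) r n ≡ 1
  at-r = cong length (trans
    (List.filter-accept (congruent? n r)
      (subst (+ n ∣_) (sym (ℤ.+-inverseʳ r)) (ℤ.∣ᵤ⇒∣ (n ℕ.∣0))))
    (cong (r ∷_) rest))

-- Equidistribution over the classes of a coprime modulus

-- Euclid's lemma: a common divisor of `n` and the product is coprime to the first factor because it
-- divides `n`, hence it divides the product of the remaining factors.
coprime-product : ∀ {n ms} → All (Coprime n) ms → Coprime n (product ms)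
coprime-product []               (_ , d∣1)    = ℕ.∣1⇒≡1 d∣1
coprime-product (n⊥m ∷ n⊥ms) (d∣n , d∣mp) = coprime-product n⊥ms
  (d∣n , Coprime.coprime-divisor
           (λ (e∣d , e∣m) → n⊥m (ℕ.∣-trans e∣d d∣n , e∣m)) d∣mp)

-- Bézout over the naturals has two forms. From `1 + y * n ≡ x * m` the witness is `t * x * m`; from
-- `1 + x * m ≡ y * n` it is `- t * x * m`.
chinese-remainder : ∀ {m n} → Coprime m n →
                    ∀ t → ∃ λ s → + m ∣ s × + n ∣ s ℤ.- t
chinese-remainder {m} {n} m⊥n t with Coprime.coprime-Bézout m⊥n
... | Bézout.+- x y eq = t ℤ.* + x ℤ.* + m , ℤ.∣n⇒∣m*n (t ℤ.* + x) ℤ.∣-refl ,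
      ℤ.divides (t ℤ.* + y) (trans (cong (ℤ._- t) (trans (ℤ.*-assoc t (+ x) (+ m))
        (cong (t ℤ.*_) (trans (sym (ℤ.pos-* x m)) (trans (cong +_ (sym eq))
          (cong (ℤ._+_ (+ 1)) (ℤ.pos-* y n))))))) (expand t (+ y) (+ n)))
  where
  expand : ∀ t y n → t ℤ.* (+ 1 ℤ.+ y ℤ.* n) ℤ.- t ≡ t ℤ.* y ℤ.* n
  expand = solve-∀
... | Bézout.-+ x y eq = ℤ.- t ℤ.* + x ℤ.* + m , ℤ.∣n⇒∣m*n (ℤ.- t ℤ.* + x) ℤ.∣-refl ,
      ℤ.divides (ℤ.- t ℤ.* + y) (trans (collect t (+ x) (+ m))
        (trans (cong (ℤ.- t ℤ.*_) (trans (cong (ℤ._+_ (+ 1)) (sym (ℤ.pos-* x m)))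
          (trans (cong +_ eq) (ℤ.pos-* y n)))) (sym (ℤ.*-assoc (ℤ.- t) (+ y) (+ n)))))
  where
  collect : ∀ t x m → ℤ.- t ℤ.* x ℤ.* m ℤ.- t ≡ ℤ.- t ℤ.* (+ 1 ℤ.+ x ℤ.* m)
  collect = solve-∀

avoids-shift : ∀ {cs s} → All (λ c → + modulus c ∣ s) cs →
               ∀ x → Avoids cs x → Avoids cs (x ℤ.+ s)
avoids-shift         []           x []         = []
avoids-shift {c ∷ _} (m∣s ∷ ms∣s) x (¬h ∷ ¬hs) =
  ¬h ∘ ∣-unshift m∣s (x+L-r x _ (+ residue c)) ∷ avoids-shift ms∣s x ¬hs

avoids-unshift : ∀ {cs s} → All (λ c → + modulus c ∣ s) cs →
                 ∀ x → Avoids cs (x ℤ.+ s) → Avoids cs x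
avoids-unshift         []           x []         = []
avoids-unshift {c ∷ _} (m∣s ∷ ms∣s) x (¬h ∷ ¬hs) =
  ¬h ∘ ∣-shift m∣s (x+L-r x _ (+ residue c)) ∷ avoids-unshift ms∣s x ¬hs

avoidsIn? : ∀ cs n r → Decidable (λ x → Avoids cs x × + n ∣ x ℤ.- r)
avoidsIn? cs n r x = avoids? cs x ×-dec congruent? n r x

module _ {cs n L} .{{_ : NonZero n}} .{{_ : NonZero L}} (n∣L : + n ∣ + L)
         (ms∣L : All (λ c → + modulus c ∣ + L) cs)
         (n⊥ms : All (λ c → Coprime n (modulus c)) cs) where

  -- Take `s` divisible by `period cs` with `s` congruent to `r′ - r` modulo `n`. Translation by `s`
  -- preserves avoidance of `cs` and carries the class of `r` to the class of `r′`.
  count-avoidsIn-const : ∀ r r′ → count (avoidsIn? cs n r′) (+ 0) L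
                                ≡ count (avoidsIn? cs n r) (+ 0) L
  count-avoidsIn-const r r′
    with s , M∣s , n∣s-t ← chinese-remainder
           (Coprime.sym (coprime-product (All.map⁺ n⊥ms))) (r′ ℤ.- r) =
    -- The translated window starts at `s`; periodicity modulo `L` allows it to replace the window
    -- at 0.
    trans (sym (count-period (+ 0 ℤ.+ s)))
      (count-translate (avoidsIn? cs n r) (avoidsIn? cs n r′) s
        (λ x (av , n∣) → avoids-shift ms∣s x av , ∣-shift n∣s-t (regroup x s r r′) n∣)
        (λ x (av , n∣) → avoids-unshift ms∣s x av , ∣-unshift n∣s-t (regroup x s r r′) n∣)
        (+ 0) L)
    where
    open Periodic (avoidsIn? cs n r′) L
      (λ x (av , n∣) → avoids-shift ms∣L x av , ∣-shift n∣L (x+L-r x (+ L) r′) n∣)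
      (λ x (av , n∣) → avoids-unshift ms∣L x av , ∣-unshift n∣L (x+L-r x (+ L) r′) n∣)
    ms∣s : All (λ c → + modulus c ∣ s) cs
    ms∣s = All.tabulate λ c∈cs → ℤ.∣-trans (modulus∣period c∈cs) M∣s
    regroup : ∀ x s r r′ → x ℤ.+ s ℤ.- r′ ≡ (x ℤ.- r) ℤ.+ (s ℤ.- (r′ ℤ.- r))
    regroup = solve-∀

  -- The `n` residue classes partition the integers avoiding `cs`, and all have the same share by
  -- `count-avoidsIn-const`. Summing over the residues and exchanging the sums gives the total.
  count-avoidsIn : ∀ r → n ℕ.* count (avoidsIn? cs n r) (+ 0) L
                       ≡ count (avoids? cs) (+ 0) L
  count-avoidsIn r = begin
    n ℕ.* k
      ≡⟨ cong (ℕ._* k) (length-window (congruent? n r) (+ 0) n) ⟨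
    length residues ℕ.* k
      ≡⟨ ∑-const k residues ⟨
    ∑ residues (λ _ → k)
      ≡⟨ ∑-cong residues (λ r′ → count-avoidsIn-const r′ r) ⟩
    ∑ residues (λ r′ → count (avoidsIn? cs n r′) (+ 0) L)
      ≡⟨ ∑-cong residues (λ r′ → trans (length-filter≡∑ (avoidsIn? cs n r′) xs)
           (∑-cong xs (λ x → 𝟙-× (avoids? cs x) (congruent? n r′ x)))) ⟩
    ∑ residues (λ r′ → ∑ xs (λ x → 𝟙 (avoids? cs x) ℕ.* 𝟙 (congruent? n r′ x)))
      ≡⟨ ∑-swap (λ r′ x → 𝟙 (avoids? cs x) ℕ.* 𝟙 (congruent? n r′ x)) residues xs ⟩
    ∑ xs (λ x → ∑ residues (λ r′ → 𝟙 (avoids? cs x) ℕ.* 𝟙 (congruent? n r′ x)))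
      ≡⟨ ∑-cong xs one-residue ⟩
    ∑ xs (𝟙 ∘ avoids? cs)
      ≡⟨ length-filter≡∑ (avoids? cs) xs ⟨
    count (avoids? cs) (+ 0) L ∎
    where
    open ≡-Reasoning
    k = count (avoidsIn? cs n r) (+ 0) L
    residues = window (+ 0) n
    xs = window (+ 0) L
    one-residue : ∀ x → ∑ residues (λ r′ → 𝟙 (avoids? cs x) ℕ.* 𝟙 (congruent? n r′ x))
                      ≡ 𝟙 (avoids? cs x)
    one-residue x with avoids? cs x
    ... | no  _ = trans (∑-const 0 residues) (ℕ.*-zeroʳ (length residues))
    -- Congruence is symmetric, so the residues `r′` matching `x` are the elements of `residues`
    -- congruent to `x`; `count-congruent` finds exactly one.
    ... | yes _ = trans (∑-cong residues λ r′ → trans (ℕ.*-identityˡ _)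
                    (𝟙-cong (congruent? n r′ x) (congruent? n x r′)
                            (∣-flip x r′) (∣-flip r′ x)))
                  (trans (sym (length-filter≡∑ (congruent? n x) residues))
                         (count-congruent n x))

-- The sieve inequality

-- Avoiding [] is no condition, so this counts the class d itself.
hits : ResidueClass → ℕ → ℕ
hits d L = count (avoidsIn? [] (modulus d) (+ residue d)) (+ 0) L

-- The case `cs = []` of `count-avoidsIn`, where all `L` integers of the window avoid the empty
-- list.
modulus*hits : ∀ d L .{{_ : NonZero L}} → + modulus d ∣ + L → modulus d ℕ.* hits d L ≡ L
modulus*hits d L m∣L = trans
  (count-avoidsIn {[]} {{modulus≢0 d}} m∣L [] [] (+ residue d))
  (trans (cong length (List.filter-all (avoids? [])
                        (All.universal {P = Avoids []} (λ _ → []) (window (+ 0) L))))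
         (length-window (avoids? []) (+ 0) L))

-- Union bound: an `x` that avoids the kept classes but not all of `cs` lies in some discarded
-- class, and that class contributes 1 to the sum.
avoids-filter-≤ : {S : Pred ResidueClass 0ℓ} (S? : Decidable S) (cs : List ResidueClass) →
  ∀ x → 𝟙 (avoids? (filter (¬? ∘ S?) cs) x) ℕ.≤
        𝟙 (avoids? cs x) ℕ.+
        ∑ (filter S? cs) (λ d → 𝟙 (avoidsIn? [] (modulus d) (+ residue d) x))
avoids-filter-≤ {S} S? cs x = go (Any.any? hit? (filter S? cs))
  where
  hit? : Decidable (λ d → Avoids [] x × + modulus d ∣ x ℤ.- + residue d)
  hit? d = avoidsIn? [] (modulus d) (+ residue d) x
  go : Dec (Any (λ d → Avoids [] x × + modulus d ∣ x ℤ.- + residue d) (filter S? cs)) → _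
  -- The indicator of `yes h` computes to 1, so this step bounds the left side by 1, whether or not
  -- `x` avoids the kept classes.
  go (yes h) = ℕ.≤-trans (𝟙-mono (avoids? (filter (¬? ∘ S?) cs) x) (yes h) (λ _ → h))
                         (ℕ.m≤n⇒m≤o+n (𝟙 (avoids? cs x)) (∑-any hit? h))
  go (no ¬h) = ℕ.m≤n⇒m≤n+o _ (𝟙-mono (avoids? (filter (¬? ∘ S?) cs) x) (avoids? cs x) λ av →
    All.tabulate λ {d} d∈cs d-hits → case-S d∈cs (S? d) av d-hits)
    where
    case-S : ∀ {d} → d ∈ cs → Dec (S d) → Avoids (filter (¬? ∘ S?) cs) x →
             ¬ + modulus d ∣ x ℤ.- + residue d
    case-S d∈cs (yes s) av d-hits =
      All.lookup (All.¬Any⇒All¬ _ ¬h) (∈-filter⁺ S? d∈cs s) ([] , d-hits)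
    case-S d∈cs (no ¬s) av d-hits =
      All.lookup av (∈-filter⁺ (¬? ∘ S?) d∈cs ¬s) d-hits

-- If `x` avoids `cs` but lies in `c`, it avoids every sublist of `cs` as well. Weakening to a
-- sublist permits keeping only the moduli coprime to that of `c`.
avoids-cons-≤ : {S : Pred ResidueClass 0ℓ} (S? : Decidable S) → ∀ c cs x →
  𝟙 (avoids? cs x) ℕ.≤
  𝟙 (avoids? (c ∷ cs) x) ℕ.+
  𝟙 (avoidsIn? (filter S? cs) (modulus c) (+ residue c) x)
avoids-cons-≤ S? c cs x = 𝟙-⊎ (avoids? cs x) (avoids? (c ∷ cs) x)
  (avoidsIn? (filter S? cs) (modulus c) (+ residue c) x)
  (split (congruent? (modulus c) (+ residue c) x))
  where
  split : Dec (+ modulus c ∣ x ℤ.- + residue c) → Avoids cs x →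
          Avoids (c ∷ cs) x ⊎
          (Avoids (filter S? cs) x × + modulus c ∣ x ℤ.- + residue c)
  split (yes h) av = inj₂ (All.filter⁺ S? av , h)
  split (no ¬h) av = inj₁ (¬h ∷ av)

nonCoprimeTo coprimeTo : ResidueClass → List ResidueClass → List ResidueClass
nonCoprimeTo c = filter (λ d → notCoprime? (c , d))
coprimeTo    c = filter (λ d → ¬? (notCoprime? (c , d)))

¬NotCoprime⇒Coprime : ∀ c d → ¬ NotCoprime (c , d) → Coprime (modulus c) (modulus d)
¬NotCoprime⇒Coprime c d gcd≯1 = Coprime.gcd≡1⇒coprime (ℕ.≤-antisym (ℕ.≮⇒≥ gcd≯1)
  (ℕ.>-nonZero⁻¹ _ {{ℕ.≢-nonZero (GCD.gcd[m,n]≢0 (modulus c) (modulus d)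
    (inj₁ (ℕ.≢-nonZero⁻¹ _ {{modulus≢0 c}})))}}))

-- The sieve inequality over one window, multiplied by the modulus of `c` and written without
-- subtraction so that it stays in the naturals.
count-cons-≥ : ∀ c cs L .{{_ : NonZero L}} →
  All (λ d → + modulus d ∣ + L) (c ∷ cs) →
  modulus c ℕ.* count (avoids? cs) (+ 0) L ℕ.≤
  modulus c ℕ.* count (avoids? (c ∷ cs)) (+ 0) L ℕ.+
  (count (avoids? cs) (+ 0) L ℕ.+ ∑ (nonCoprimeTo c cs) (λ d → hits d L))
count-cons-≥ c cs L (n∣L ∷ ms∣L) = begin
  n ℕ.* count (avoids? cs) (+ 0) L
    ≤⟨ ℕ.*-monoʳ-≤ n split ⟩
  n ℕ.* (count (avoids? (c ∷ cs)) (+ 0) L ℕ.+ count in? (+ 0) L)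
    ≡⟨ ℕ.*-distribˡ-+ n (count (avoids? (c ∷ cs)) (+ 0) L) _ ⟩
  n ℕ.* count (avoids? (c ∷ cs)) (+ 0) L ℕ.+ n ℕ.* count in? (+ 0) L
    -- Equidistribution applies because only classes with modulus coprime to `n` remain in
    -- `coprimeTo c cs`.
    ≡⟨ cong (n ℕ.* count (avoids? (c ∷ cs)) (+ 0) L ℕ.+_)
         (count-avoidsIn {{modulus≢0 c}} n∣L (All.filter⁺ coprime? ms∣L)
           (All.map (λ {d} → ¬NotCoprime⇒Coprime c d) (All.all-filter coprime? cs))
           (+ residue c)) ⟩
  n ℕ.* count (avoids? (c ∷ cs)) (+ 0) L ℕ.+ count (avoids? (coprimeTo c cs)) (+ 0) L
    -- Putting the classes not coprime to `c` back costs at most their total number of hits.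
    ≤⟨ ℕ.+-monoʳ-≤ (n ℕ.* count (avoids? (c ∷ cs)) (+ 0) L) restore ⟩
  n ℕ.* count (avoids? (c ∷ cs)) (+ 0) L ℕ.+
    (count (avoids? cs) (+ 0) L ℕ.+ ∑ (nonCoprimeTo c cs) (λ d → hits d L)) ∎
  where
  open ℕ.≤-Reasoning
  n = modulus c
  xs = window (+ 0) L
  coprime? = λ d → ¬? (notCoprime? (c , d))
  in? = avoidsIn? (coprimeTo c cs) n (+ residue c)
  hit? = λ d → avoidsIn? [] (modulus d) (+ residue d)
  split : count (avoids? cs) (+ 0) L ℕ.≤
          count (avoids? (c ∷ cs)) (+ 0) L ℕ.+ count in? (+ 0) L
  split = begin
    count (avoids? cs) (+ 0) L  ≡⟨ length-filter≡∑ (avoids? cs) xs ⟩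
    ∑ xs (𝟙 ∘ avoids? cs)       ≤⟨ ∑-mono-≤ xs (avoids-cons-≤ coprime? c cs) ⟩
    ∑ xs (λ x → 𝟙 (avoids? (c ∷ cs) x) ℕ.+ 𝟙 (in? x))
      ≡⟨ ∑-+ (𝟙 ∘ avoids? (c ∷ cs)) (𝟙 ∘ in?) xs ⟩
    ∑ xs (𝟙 ∘ avoids? (c ∷ cs)) ℕ.+ ∑ xs (𝟙 ∘ in?)
      ≡⟨ cong₂ ℕ._+_ (length-filter≡∑ (avoids? (c ∷ cs)) xs) (length-filter≡∑ in? xs) ⟨
    count (avoids? (c ∷ cs)) (+ 0) L ℕ.+ count in? (+ 0) L ∎
  restore : count (avoids? (coprimeTo c cs)) (+ 0) L ℕ.≤
            count (avoids? cs) (+ 0) L ℕ.+ ∑ (nonCoprimeTo c cs) (λ d → hits d L)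
  restore = begin
    count (avoids? (coprimeTo c cs)) (+ 0) L
      ≡⟨ length-filter≡∑ (avoids? (coprimeTo c cs)) xs ⟩
    ∑ xs (𝟙 ∘ avoids? (coprimeTo c cs))
      ≤⟨ ∑-mono-≤ xs (avoids-filter-≤ (λ d → notCoprime? (c , d)) cs) ⟩
    ∑ xs (λ x → 𝟙 (avoids? cs x) ℕ.+ ∑ (nonCoprimeTo c cs) (λ d → 𝟙 (hit? d x)))
      ≡⟨ ∑-+ (𝟙 ∘ avoids? cs) _ xs ⟩
    ∑ xs (𝟙 ∘ avoids? cs) ℕ.+ ∑ xs (λ x → ∑ (nonCoprimeTo c cs) (λ d → 𝟙 (hit? d x)))
      ≡⟨ cong₂ ℕ._+_ (sym (length-filter≡∑ (avoids? cs) xs))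
           (trans (∑-swap (λ x d → 𝟙 (hit? d x)) xs (nonCoprimeTo c cs))
                  (∑-cong (nonCoprimeTo c cs) λ d → sym (length-filter≡∑ (hit? d) xs))) ⟩
    count (avoids? cs) (+ 0) L ℕ.+ ∑ (nonCoprimeTo c cs) (λ d → hits d L) ∎

-- Natural fractions

/-cross : ∀ a b c d .{{_ : NonZero b}} .{{_ : NonZero d}} →
          a ℕ.* d ≡ c ℕ.* b → + a / b ≡ + c / d
/-cross a (suc b) c (suc d) ad≡cb = ℚ.fromℚᵘ-cong {mkℚᵘ (+ a) b} {mkℚᵘ (+ c) d}
  (*≡* (trans (sym (ℤ.pos-* a (suc d))) (trans (cong +_ ad≡cb) (ℤ.pos-* c (suc b)))))

/-mono-≤ : ∀ a c b .{{_ : NonZero b}} → a ℕ.≤ c → + a / b ℚ.≤ + c / b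
/-mono-≤ a c (suc b) a≤c = ℚ.toℚᵘ-cancel-≤
  (ℚᵘ.≤-respˡ-≃ (ℚᵘ.≃-sym (ℚ.toℚᵘ-fromℚᵘ (mkℚᵘ (+ a) b)))
  (ℚᵘ.≤-respʳ-≃ (ℚᵘ.≃-sym (ℚ.toℚᵘ-fromℚᵘ (mkℚᵘ (+ c) b)))
    (*≤* (ℤ.*-monoʳ-≤-nonNeg (+ suc b) (ℤ.+≤+ a≤c)))))

/-+ : ∀ a c b .{{_ : NonZero b}} → + (a ℕ.+ c) / b ≡ + a / b ℚ.+ + c / b
/-+ a c (suc b) = ℚ.toℚᵘ-injective (begin
  ℚ.toℚᵘ (+ (a ℕ.+ c) / suc b)        ≈⟨ ℚ.toℚᵘ-fromℚᵘ (mkℚᵘ (+ (a ℕ.+ c)) b) ⟩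
  mkℚᵘ (+ (a ℕ.+ c)) b                ≈⟨ *≡* (distrib (+ a) (+ c) (+ suc b)) ⟩
  mkℚᵘ (+ a) b ℚᵘ.+ mkℚᵘ (+ c) b
    ≈⟨ ℚᵘ.+-cong (ℚ.toℚᵘ-fromℚᵘ (mkℚᵘ (+ a) b)) (ℚ.toℚᵘ-fromℚᵘ (mkℚᵘ (+ c) b)) ⟨
  ℚ.toℚᵘ (+ a / suc b) ℚᵘ.+ ℚ.toℚᵘ (+ c / suc b)
    ≈⟨ ℚ.toℚᵘ-homo-+ (+ a / suc b) (+ c / suc b) ⟨
  ℚ.toℚᵘ (+ a / suc b ℚ.+ + c / suc b) ∎)
  where
  open import Relation.Binary.Reasoning.Setoid ℚᵘ.≃-setoid
  distrib : ∀ a c b → (a ℤ.+ c) ℤ.* (b ℤ.* b) ≡ (a ℤ.* b ℤ.+ c ℤ.* b) ℤ.* b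
  distrib = solve-∀

/-* : ∀ a b c d .{{_ : NonZero b}} .{{_ : NonZero d}} →
      (+ (a ℕ.* c) / (b ℕ.* d)) {{ℕ.m*n≢0 b d}} ≡ (+ a / b) ℚ.* (+ c / d)
/-* a (suc b) c (suc d) = ℚ.toℚᵘ-injective (begin
  ℚ.toℚᵘ (+ (a ℕ.* c) / (suc b ℕ.* suc d))
    ≈⟨ ℚ.toℚᵘ-fromℚᵘ (mkℚᵘ (+ (a ℕ.* c)) _) ⟩
  mkℚᵘ (+ (a ℕ.* c)) (ℕ.pred (suc b ℕ.* suc d))
    ≈⟨ *≡* (cong (ℤ._* + (suc b ℕ.* suc d)) (ℤ.pos-* a c)) ⟩
  mkℚᵘ (+ a) b ℚᵘ.* mkℚᵘ (+ c) d
    ≈⟨ ℚᵘ.*-cong (ℚ.toℚᵘ-fromℚᵘ (mkℚᵘ (+ a) b)) (ℚ.toℚᵘ-fromℚᵘ (mkℚᵘ (+ c) d)) ⟨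
  ℚ.toℚᵘ (+ a / suc b) ℚᵘ.* ℚ.toℚᵘ (+ c / suc d)
    ≈⟨ ℚ.toℚᵘ-homo-* (+ a / suc b) (+ c / suc d) ⟨
  ℚ.toℚᵘ ((+ a / suc b) ℚ.* (+ c / suc d)) ∎)
  where open import Relation.Binary.Reasoning.Setoid ℚᵘ.≃-setoid

0/n≤ : ∀ a b .{{_ : NonZero b}} → 0ℚ ℚ.≤ + a / b
0/n≤ a b = subst (ℚ._≤ + a / b) (ℚ.0/n≡0 b) (/-mono-≤ 0 a b ℕ.z≤n)

-- Rational sums

∑ℚ : List A → (A → ℚ) → ℚ
∑ℚ xs f = foldr ℚ._+_ 0ℚ (map f xs)

∑ℚ-++ : ∀ (f : A → ℚ) xs ys → ∑ℚ (xs ++ ys) f ≡ ∑ℚ xs f ℚ.+ ∑ℚ ys f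
∑ℚ-++ f []       ys = sym (ℚ.+-identityˡ _)
∑ℚ-++ f (x ∷ xs) ys = trans (cong (f x ℚ.+_) (∑ℚ-++ f xs ys))
                            (sym (ℚ.+-assoc (f x) _ _))

∑ℚ-nonNeg : ∀ (f : A → ℚ) xs → (∀ x → 0ℚ ℚ.≤ f x) → 0ℚ ℚ.≤ ∑ℚ xs f
∑ℚ-nonNeg f []       0≤f = ℚ.≤-refl
∑ℚ-nonNeg f (x ∷ xs) 0≤f = ℚ.+-mono-≤ (0≤f x) (∑ℚ-nonNeg f xs 0≤f)

∑-/ : ∀ (f : A → ℕ) (g : A → ℚ) L .{{_ : NonZero L}} {xs} →
      All (λ x → + f x / L ≡ g x) xs → + ∑ xs f / L ≡ ∑ℚ xs g
∑-/ f g L []                = ℚ.0/n≡0 L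
∑-/ f g L {x ∷ xs} (eq ∷ eqs) = trans (/-+ (f x) (∑ xs f) L) (cong₂ ℚ._+_ eq (∑-/ f g L eqs))

-- Densities

density : List ResidueClass → ℚ
density cs = (+ count (avoids? cs) (+ 0) (period cs) / period cs) {{period≢0 cs}}

-- The window consists of `k` periods with equal counts. With `k` the modulus of `c`, this expresses
-- `density cs` over the period of `c ∷ cs`.
density-multiple : ∀ k cs .{{_ : NonZero (k ℕ.* period cs)}} →
  + count (avoids? cs) (+ 0) (k ℕ.* period cs) / (k ℕ.* period cs) ≡ density cs
density-multiple k cs = /-cross (count (avoids? cs) (+ 0) (k ℕ.* period cs)) (k ℕ.* period cs) perPeriod (period cs)
  (trans (cong (ℕ._* period cs) (count-periods (+ 0) k))
         (reorder k perPeriod (period cs)))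
  where
  instance _ = period≢0 cs
  open Periodic (avoids? cs) (period cs) (avoids⇒ cs) (avoids⇐ cs)
  reorder : ∀ k p m → k ℕ.* p ℕ.* m ≡ p ℕ.* (k ℕ.* m)
  reorder = ℕ.solve-∀

reciprocal : ResidueClass → ℚ
reciprocal c = (+ 1 / modulus c) {{modulus≢0 c}}

-- This is `count-cons-≥` divided by `n * L`, where `L` is the period of `c ∷ cs` and therefore also
-- a multiple of `period cs`.
density-cons-≥ : ∀ c cs → density cs ℚ.≤ density (c ∷ cs) ℚ.+
  (reciprocal c ℚ.* density cs ℚ.+ ∑ℚ (nonCoprimeTo c cs) (λ d → βTerm (c , d)))
density-cons-≥ c cs = begin
  density cs                        ≡⟨ density-multiple n cs ⟨
  + b / L                           ≡⟨ /-cross b L (n ℕ.* b) (n ℕ.* L) (reorder b n L) ⟩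
  + (n ℕ.* b) / (n ℕ.* L)           ≤⟨ /-mono-≤ _ _ (n ℕ.* L) (count-cons-≥ c cs L ms∣L) ⟩
  + (n ℕ.* a ℕ.+ (b ℕ.+ h)) / (n ℕ.* L)
    ≡⟨ trans (/-+ (n ℕ.* a) (b ℕ.+ h) (n ℕ.* L))
             (cong (+ (n ℕ.* a) / (n ℕ.* L) ℚ.+_) (/-+ b h (n ℕ.* L))) ⟩
  + (n ℕ.* a) / (n ℕ.* L) ℚ.+ (+ b / (n ℕ.* L) ℚ.+ + h / (n ℕ.* L))
    ≡⟨ cong₂ ℚ._+_ (/-cross (n ℕ.* a) (n ℕ.* L) a L (sym (reorder a n L)))
         (cong₂ ℚ._+_ b/nL (∑-/ (λ d → hits d L) (λ d → βTerm (c , d)) (n ℕ.* L)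
           (All.map (λ {d} → hits/nL d) (All.filter⁺ (λ d → notCoprime? (c , d)) (All.tail ms∣L))))) ⟩
  density (c ∷ cs) ℚ.+
    (reciprocal c ℚ.* density cs ℚ.+ ∑ℚ (nonCoprimeTo c cs) (λ d → βTerm (c , d))) ∎
  where
  open ℚ.≤-Reasoning
  n = modulus c
  L = period (c ∷ cs)
  instance
    n≢0 = modulus≢0 c
    L≢0 = period≢0 (c ∷ cs)
    nL≢0 = ℕ.m*n≢0 n L
  a = count (avoids? (c ∷ cs)) (+ 0) L
  b = count (avoids? cs) (+ 0) L
  h = ∑ (nonCoprimeTo c cs) (λ d → hits d L)
  ms∣L : All (λ d → + modulus d ∣ + L) (c ∷ cs)
  ms∣L = All.tabulate modulus∣period
  reorder : ∀ b n L → b ℕ.* (n ℕ.* L) ≡ n ℕ.* b ℕ.* L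
  reorder = ℕ.solve-∀
  b/nL : + b / (n ℕ.* L) ≡ reciprocal c ℚ.* density cs
  b/nL = trans (trans (cong (λ b → + b / (n ℕ.* L)) (sym (ℕ.*-identityˡ b))) (/-* 1 n b L))
               (cong (reciprocal c ℚ.*_) (density-multiple n cs))
  -- The class `d` fills a share of one over its modulus; the further factor `n` in the denominator
  -- turns this into the pair term of `c` and `d`.
  hits/nL : ∀ d → + modulus d ∣ + L → + hits d L / (n ℕ.* L) ≡ βTerm (c , d)
  hits/nL d m∣L = /-cross (hits d L) (n ℕ.* L) 1 (n ℕ.* modulus d)
    {{nL≢0}} {{ℕ.m*n≢0 n (modulus d) {{n≢0}} {{modulus≢0 d}}}}
    (trans (rotate (hits d L) n (modulus d))
      (trans (cong (n ℕ.*_) (modulus*hits d L m∣L)) (sym (ℕ.*-identityˡ _))))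
    where
    rotate : ∀ h n m → h ℕ.* (n ℕ.* m) ≡ n ℕ.* (m ℕ.* h)
    rotate = ℕ.solve-∀

-- The main terms on lists and the induction

αOf βOf : List ResidueClass → ℚ
αOf cs = foldr ℚ._*_ 1ℚ (map αFactor cs)
βOf cs = ∑ℚ (filter notCoprime? (orderedPairs cs)) βTerm

0≤βTerm : ∀ p → 0ℚ ℚ.≤ βTerm p
0≤βTerm (class m _ , class n _) = 0/n≤ 1 (m ℕ.* n) {{ℕ.m*n≢0 m n}}

filter-map : {S : Pred B 0ℓ} (S? : Decidable S) (f : A → B) (xs : List A) →
             filter S? (map f xs) ≡ map f (filter (S? ∘ f) xs)
filter-map S? f []       = refl
filter-map S? f (x ∷ xs) with S? (f x)
... | yes _ = cong (f x ∷_) (filter-map S? f xs)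
... | no  _ = filter-map S? f xs

-- The pairs with first entry the head `c` come first in `orderedPairs (c ∷ cs)`, and on them
-- `notCoprime?` is the very test that defines `nonCoprimeTo c`.
βOf-cons : ∀ c cs →
  βOf (c ∷ cs) ≡ ∑ℚ (nonCoprimeTo c cs) (λ d → βTerm (c , d)) ℚ.+ βOf cs
βOf-cons c cs = begin
  ∑ℚ (filter notCoprime? (map (c ,_) cs ++ orderedPairs cs)) βTerm
    ≡⟨ cong (λ ps → ∑ℚ ps βTerm)
         (trans (List.filter-++ notCoprime? (map (c ,_) cs) _)
                (cong (_++ _) (filter-map notCoprime? (c ,_) cs))) ⟩
  ∑ℚ (map (c ,_) (nonCoprimeTo c cs) ++ filter notCoprime? (orderedPairs cs)) βTerm
    ≡⟨ ∑ℚ-++ βTerm (map (c ,_) (nonCoprimeTo c cs)) _ ⟩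
  ∑ℚ (map (c ,_) (nonCoprimeTo c cs)) βTerm ℚ.+ βOf cs
    ≡⟨ cong (λ ts → foldr ℚ._+_ 0ℚ ts ℚ.+ βOf cs) (List.map-∘ (nonCoprimeTo c cs)) ⟨
  ∑ℚ (nonCoprimeTo c cs) (λ d → βTerm (c , d)) ℚ.+ βOf cs ∎
  where open ≡-Reasoning

0≤reciprocal : ∀ c → 0ℚ ℚ.≤ reciprocal c
0≤reciprocal c = 0/n≤ 1 (modulus c) {{modulus≢0 c}}

reciprocal≤1 : ∀ c → reciprocal c ℚ.≤ 1ℚ
reciprocal≤1 c = subst (reciprocal c ℚ.≤_)
  (/-cross n n 1 1 (ℕ.*-comm n 1))
  (/-mono-≤ 1 n n (ℕ.>-nonZero⁻¹ n))
  where
  n = modulus c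
  instance _ = modulus≢0 c

-- The arithmetic of one induction step: `u` is the reciprocal of the new modulus, `x` and `y` are
-- the densities before and after adding the class, and `γ` sums the new pair terms. The hypothesis
-- on `x` is multiplied by `1ℚ - u`, which is nonnegative.
sieve-step : ∀ {u x y α β γ} → 0ℚ ℚ.≤ u → u ℚ.≤ 1ℚ → 0ℚ ℚ.≤ β →
          α - β ℚ.≤ x → x ℚ.≤ y ℚ.+ (u ℚ.* x ℚ.+ γ) →
          (1ℚ - u) ℚ.* α - (γ ℚ.+ β) ℚ.≤ y
sieve-step {u} {x} {y} {α} {β} {γ} 0≤u u≤1 0≤β α-β≤x x≤ = begin
  (1ℚ - u) ℚ.* α - (γ ℚ.+ β)
    ≡⟨ solve 4 (λ u α β γ → (con 1ℚ :- u) :* α :- (γ :+ β)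
                 := (con 1ℚ :- u) :* (α :- β) :- γ :- u :* β) refl u α β γ ⟩
  (1ℚ - u) ℚ.* (α - β) - γ - u ℚ.* β
    -- The old error `β` also shrinks by the factor `1ℚ - u`; this gain of `u * β` is given up.
    ≤⟨ ℚ.+-monoʳ-≤ ((1ℚ - u) ℚ.* (α - β) - γ) (ℚ.neg-antimono-≤ 0≤uβ) ⟩
  (1ℚ - u) ℚ.* (α - β) - γ - 0ℚ
    ≡⟨ ℚ.+-identityʳ _ ⟩
  (1ℚ - u) ℚ.* (α - β) - γ
    ≤⟨ ℚ.+-monoˡ-≤ (ℚ.- γ) (ℚ.*-monoˡ-≤-nonNeg (1ℚ - u) {{ℚ.nonNegative 0≤1-u}} α-β≤x) ⟩
  (1ℚ - u) ℚ.* x - γ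
    ≡⟨ solve 3 (λ u x γ → (con 1ℚ :- u) :* x :- γ := x :- (u :* x :+ γ)) refl u x γ ⟩
  x - (u ℚ.* x ℚ.+ γ)
    ≤⟨ ℚ.+-monoˡ-≤ (ℚ.- (u ℚ.* x ℚ.+ γ)) x≤ ⟩
  y ℚ.+ (u ℚ.* x ℚ.+ γ) - (u ℚ.* x ℚ.+ γ)
    ≡⟨ solve 2 (λ y z → y :+ z :- z := y) refl y (u ℚ.* x ℚ.+ γ) ⟩
  y ∎
  where
  open ℚ.≤-Reasoning
  open +-*-Solver
  0≤1-u : 0ℚ ℚ.≤ 1ℚ - u
  0≤1-u = subst (ℚ._≤ 1ℚ - u) (ℚ.+-inverseʳ u) (ℚ.+-monoˡ-≤ (ℚ.- u) u≤1)
  0≤uβ : 0ℚ ℚ.≤ u ℚ.* β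
  0≤uβ = subst (ℚ._≤ u ℚ.* β) (ℚ.*-zeroʳ u)
               (ℚ.*-monoˡ-≤-nonNeg u {{ℚ.nonNegative 0≤u}} 0≤β)

density-≥ : ∀ cs → αOf cs - βOf cs ℚ.≤ density cs
-- Both sides compute to 1: the empty product minus the empty sum, and one integer out of a period
-- of length 1.
density-≥ []       = ℚ.≤-refl
density-≥ (c ∷ cs) = subst (λ β → αOf (c ∷ cs) - β ℚ.≤ density (c ∷ cs))
  (sym (βOf-cons c cs))
  (sieve-step (0≤reciprocal c) (reciprocal≤1 c)
    (∑ℚ-nonNeg βTerm (filter notCoprime? (orderedPairs cs)) 0≤βTerm)
    (density-≥ cs) (density-cons-≥ c cs))

lemma2p1 : (C : ResidueSystem) → δ C ≥ α C - β C
-- `δ C`, `α C` and `β C` unfold to `density`, `αOf` and `βOf` of `classes C`.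
lemma2p1 C = density-≥ (classes C)
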